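{- For every positive integer $n$, $$\sum_{k=0}^{n-1}\frac{q^{ -k(k-1)/2}}{\genfrac{[}{]}{0pt}{}{n}{k}_q}=\frac{(q^2;q)_n}{(q^2;q^2)_n}\sum_{i=0}^{n-1}\frac{C(i)\,(q^2;q^2)_i}{(q^2;q)_i\,(q^{i+2}-1)},$$ where $$C(i)=\frac{q^{i+1}+q^{3(i+1)}+q^{ -i(i-1)/2}+q^{ -(i+1)(i-4)/2}-q^{(2+3i-i^2)/2}-q^{ -(i+1)(i-2)/2}-2q^{2(i+1)}}{q^{i+1}-1}.$$ (The identity is an identity of rational functions in the indeterminate $q$.)
   Context: For an indeterminate $q$ and any $a$, $(a;q)_n=(1-a)(1-aq)\cdots(1-aq^{n-1})$, with $(a;q)_0=1$. The $q$-binomial coefficient is $\genfrac{[}{]}{0pt}{}{n}{k}_q=\frac{(q;q)_n}{(q;q)_k\,(q;q)_{n-k}}$ for $0\le k\le n$. -}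

module Defs where

open import Algebra.Bundles.Raw using (RawRing)
import Algebra.Definitions.RawSemiring as RawSemiringDefinitions
open import Data.Empty using (⊥-elim-irr)
open import Data.Fin.Base using (Fin; zero; suc; toℕ)
open import Data.Integer.Base as ℤ using (ℤ; +_; -[1+_])
open import Data.List.Base using (List; []; _∷_; map)
open import Data.Nat.Base as ℕ using (ℕ; zero; suc)
open import Data.Rational.Base as ℚ using (ℚ; 0ℚ; 1ℚ)
import Data.Rational.Properties as ℚ
open import Data.Sum.Base as Sum using (_⊎_; inj₁; inj₂; [_,_]′)
open import Level using (0ℓ)
open import Relation.Binary.PropositionalEquality
open import Relation.Nullary using (¬_; yes; no)

-- Coefficients in order of increasing degree; trailing zeros are allowed,
-- so polynomials are compared with _≈ₚ_ rather than _≡_.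
ℚ[q] : Set
ℚ[q] = List ℚ

coeff : ℚ[q] → ℕ → ℚ
coeff []      _       = 0ℚ
coeff (a ∷ p) zero    = a
coeff (a ∷ p) (suc i) = coeff p i

infix 4 _≈ₚ_ _≉ₚ_

record _≈ₚ_ (p r : ℚ[q]) : Set where
  constructor pointwise
  field
    at : ∀ i → coeff p i ≡ coeff r i

open _≈ₚ_ public

_≉ₚ_ : ℚ[q] → ℚ[q] → Set
p ≉ₚ r = ¬ (p ≈ₚ r)

infixl 6 _+ₚ_
infixl 7 _*ₚ_ _·ₚ_
infix  8 -ₚ_

0ₚ 1ₚ qₚ : ℚ[q]
0ₚ = []
1ₚ = 1ℚ ∷ []
qₚ = 0ℚ ∷ 1ℚ ∷ []

_+ₚ_ : ℚ[q] → ℚ[q] → ℚ[q]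
[]      +ₚ r       = r
(a ∷ p) +ₚ []      = a ∷ p
(a ∷ p) +ₚ (b ∷ r) = a ℚ.+ b ∷ p +ₚ r

-ₚ_ : ℚ[q] → ℚ[q]
-ₚ p = map (λ a → ℚ.- a) p

_·ₚ_ : ℚ → ℚ[q] → ℚ[q]
a ·ₚ r = map (a ℚ.*_) r

_*ₚ_ : ℚ[q] → ℚ[q] → ℚ[q]
[]      *ₚ r = []
(a ∷ p) *ₚ r = (a ·ₚ r) +ₚ (0ℚ ∷ p *ₚ r)

coeff-+ : ∀ p r i → coeff (p +ₚ r) i ≡ coeff p i ℚ.+ coeff r i
coeff-+ []      r       i       = sym (ℚ.+-identityˡ _)
coeff-+ (a ∷ p) []      i       = sym (ℚ.+-identityʳ _)
coeff-+ (a ∷ p) (b ∷ r) zero    = refl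
coeff-+ (a ∷ p) (b ∷ r) (suc i) = coeff-+ p r i

coeff-neg : ∀ p i → coeff (-ₚ p) i ≡ ℚ.- coeff p i
coeff-neg []      i       = refl
coeff-neg (a ∷ p) zero    = refl
coeff-neg (a ∷ p) (suc i) = coeff-neg p i

coeff-· : ∀ a r i → coeff (a ·ₚ r) i ≡ a ℚ.* coeff r i
coeff-· a []      i       = sym (ℚ.*-zeroʳ a)
coeff-· a (b ∷ r) zero    = refl
coeff-· a (b ∷ r) (suc i) = coeff-· a r i

coeff-*-step : ∀ a p r i →
  coeff ((a ∷ p) *ₚ r) i ≡ a ℚ.* coeff r i ℚ.+ coeff (0ℚ ∷ p *ₚ r) i
coeff-*-step a p r i =
  trans (coeff-+ (a ·ₚ r) (0ℚ ∷ p *ₚ r) i) (cong (ℚ._+ _) (coeff-· a r i))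

coeff-*-zero : ∀ p r → coeff (p *ₚ r) 0 ≡ coeff p 0 ℚ.* coeff r 0
coeff-*-zero []      r = sym (ℚ.*-zeroˡ (coeff r 0))
coeff-*-zero (a ∷ p) r = trans (coeff-*-step a p r 0) (ℚ.+-identityʳ _)

∷-≈0 : ∀ {a p} → a ≡ 0ℚ → p ≈ₚ 0ₚ → a ∷ p ≈ₚ 0ₚ
∷-≈0 a≡0 p≈0 .at zero    = a≡0
∷-≈0 a≡0 p≈0 .at (suc i) = p≈0 .at i

tail-≈0 : ∀ {a p} → a ∷ p ≈ₚ 0ₚ → p ≈ₚ 0ₚ
tail-≈0 p≈0 .at i = p≈0 .at (suc i)

≈ₚ-trans : ∀ {p r s} → p ≈ₚ r → r ≈ₚ s → p ≈ₚ s
≈ₚ-trans p≈r r≈s .at i = trans (p≈r .at i) (r≈s .at i)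

≈ₚ-sym : ∀ {p r} → p ≈ₚ r → r ≈ₚ p
≈ₚ-sym p≈r .at i = sym (p≈r .at i)

*ₚ-zeroˡ : ∀ p r → p ≈ₚ 0ₚ → p *ₚ r ≈ₚ 0ₚ
*ₚ-zeroˡ []      r p≈0 .at i = refl
*ₚ-zeroˡ (a ∷ p) r p≈0 .at i = trans (coeff-*-step a p r i) (cong₂ ℚ._+_
  (trans (cong (ℚ._* coeff r i) (p≈0 .at 0)) (ℚ.*-zeroˡ (coeff r i)))
  (∷-≈0 refl (*ₚ-zeroˡ p r (tail-≈0 p≈0)) .at i))

0∷-*ₚ : ∀ {a} → a ≡ 0ℚ → ∀ p r → (a ∷ p) *ₚ r ≈ₚ 0ℚ ∷ p *ₚ r
0∷-*ₚ refl p r .at i = trans (coeff-*-step 0ℚ p r i)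
  (trans (cong (ℚ._+ coeff (0ℚ ∷ p *ₚ r) i) (ℚ.*-zeroˡ (coeff r i))) (ℚ.+-identityˡ _))

*ₚ-0∷ : ∀ {b} → b ≡ 0ℚ → ∀ p r → p *ₚ (b ∷ r) ≈ₚ 0ℚ ∷ p *ₚ r
*ₚ-0∷ b≡0  []      r .at zero    = refl
*ₚ-0∷ b≡0  []      r .at (suc i) = refl
*ₚ-0∷ refl (a ∷ p) r .at zero    = trans (coeff-*-zero (a ∷ p) (0ℚ ∷ r)) (ℚ.*-zeroʳ a)
*ₚ-0∷ {b} b≡0 (a ∷ p) r .at (suc i) = trans (coeff-*-step a p (b ∷ r) (suc i))
  (trans (cong (λ c → a ℚ.* coeff r i ℚ.+ c) (*ₚ-0∷ b≡0 p r .at i)) (sym (coeff-*-step a p r i)))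

p*q≡0⇒p≡0∨q≡0 : ∀ a b → a ℚ.* b ≡ 0ℚ → a ≡ 0ℚ ⊎ b ≡ 0ℚ
p*q≡0⇒p≡0∨q≡0 a b ab≡0 with a ℚ.≟ 0ℚ
... | yes a≡0 = inj₁ a≡0
... | no  a≢0 = inj₂ (begin
  b                        ≡⟨ ℚ.*-identityˡ b ⟨
  1ℚ ℚ.* b                 ≡⟨ cong (ℚ._* b) (ℚ.*-inverseˡ a) ⟨
  (ℚ.1/ a ℚ.* a) ℚ.* b     ≡⟨ ℚ.*-assoc (ℚ.1/ a) a b ⟩
  ℚ.1/ a ℚ.* (a ℚ.* b)     ≡⟨ cong (ℚ.1/ a ℚ.*_) ab≡0 ⟩
  ℚ.1/ a ℚ.* 0ℚ            ≡⟨ ℚ.*-zeroʳ (ℚ.1/ a) ⟩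
  0ℚ                       ∎)
  where
  open ≡-Reasoning
  instance
    _ : ℚ.NonZero a
    _ = ℚ.≢-nonZero a≢0

*ₚ-domain : ∀ p r → p *ₚ r ≈ₚ 0ₚ → p ≈ₚ 0ₚ ⊎ r ≈ₚ 0ₚ
*ₚ-domain []      r       pr≈0 = inj₁ (pointwise λ _ → refl)
*ₚ-domain (a ∷ p) []      pr≈0 = inj₂ (pointwise λ _ → refl)
*ₚ-domain (a ∷ p) (b ∷ r) pr≈0 =
  [ (λ a≡0 → Sum.map₁ (∷-≈0 a≡0)
      (*ₚ-domain p (b ∷ r) (tail-≈0 (≈ₚ-trans (≈ₚ-sym (0∷-*ₚ a≡0 p (b ∷ r))) pr≈0))))
  , (λ b≡0 → Sum.map₂ (∷-≈0 b≡0)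
      (*ₚ-domain (a ∷ p) r (tail-≈0 (≈ₚ-trans (≈ₚ-sym (*ₚ-0∷ b≡0 (a ∷ p) r)) pr≈0))))
  ]′ (p*q≡0⇒p≡0∨q≡0 a b (trans (sym (coeff-*-zero (a ∷ p) (b ∷ r))) (pr≈0 .at 0)))

*ₚ-≉0 : ∀ {p r} → p ≉ₚ 0ₚ → r ≉ₚ 0ₚ → p *ₚ r ≉ₚ 0ₚ
*ₚ-≉0 {p} {r} p≉0 r≉0 pr≈0 = [ p≉0 , r≉0 ]′ (*ₚ-domain p r pr≈0)

1ₚ≉0 : 1ₚ ≉ₚ 0ₚ
1ₚ≉0 1≈0 = ℚ.1≢0 (1≈0 .at 0)

record ℚ⟨q⟩ : Set where
  no-eta-equality
  constructor mk
  field
    num   : ℚ[q]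
    den   : ℚ[q]
    den≉0 : den ≉ₚ 0ₚ

open ℚ⟨q⟩ public

infix 4 _≈_ _≉_

record _≈_ (x y : ℚ⟨q⟩) : Set where
  constructor cross
  field
    cross-eq : num x *ₚ den y ≈ₚ num y *ₚ den x

open _≈_ public

_≉_ : ℚ⟨q⟩ → ℚ⟨q⟩ → Set
x ≉ y = ¬ (x ≈ y)

infixl 6 _+_ _-_
infixl 7 _*_ _÷_
infix  8 -_

fromPoly : ℚ[q] → ℚ⟨q⟩
num   (fromPoly p) = p
den   (fromPoly p) = 1ₚ
den≉0 (fromPoly p) = 1ₚ≉0

0# 1# q : ℚ⟨q⟩
0# = fromPoly 0ₚ
1# = fromPoly 1ₚ
q  = fromPoly qₚ

_+_ _*_ : ℚ⟨q⟩ → ℚ⟨q⟩ → ℚ⟨q⟩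

num   (x + y) = num x *ₚ den y +ₚ num y *ₚ den x
den   (x + y) = den x *ₚ den y
den≉0 (x + y) = *ₚ-≉0 (den≉0 x) (den≉0 y)

num   (x * y) = num x *ₚ num y
den   (x * y) = den x *ₚ den y
den≉0 (x * y) = *ₚ-≉0 (den≉0 x) (den≉0 y)

-_ : ℚ⟨q⟩ → ℚ⟨q⟩
num   (- x) = -ₚ num x
den   (- x) = den x
den≉0 (- x) = den≉0 x

_-_ : ℚ⟨q⟩ → ℚ⟨q⟩ → ℚ⟨q⟩
x - y = x + (- y)

record NonZero (x : ℚ⟨q⟩) : Set where
  field
    nonZero : x ≉ 0#

num≉0 : ∀ x → NonZero x → num x ≉ₚ 0ₚ
num≉0 x x≉0 n≈0 = NonZero.nonZero x≉0 (cross (*ₚ-zeroˡ (num x) 1ₚ n≈0))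

≉0-num : ∀ {x} → num x ≉ₚ 0ₚ → NonZero x
≉0-num {x} n≉0 .NonZero.nonZero (cross eq) = *ₚ-≉0 n≉0 1ₚ≉0 eq

_÷_ : (x y : ℚ⟨q⟩) .{{_ : NonZero y}} → ℚ⟨q⟩
num   (x ÷ y) = num x *ₚ den y
den   (x ÷ y) = den x *ₚ num y
den≉0 (_÷_ x y {{y≉0}}) d≈0 = ⊥-elim-irr (*ₚ-≉0 (den≉0 x) (num≉0 y y≉0) d≈0)

rawRing : RawRing 0ℓ 0ℓ
rawRing = record
  { Carrier = ℚ⟨q⟩ ; _≈_ = _≈_ ; _+_ = _+_ ; _*_ = _*_ ; -_ = -_ ; 0# = 0# ; 1# = 1# }

open RawSemiringDefinitions (RawRing.rawSemiring rawRing) public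
  using (_×_; _^_; sum; product)

*-nonZero : ∀ {x y} → NonZero x → NonZero y → NonZero (x * y)
*-nonZero {x} {y} x≉0 y≉0 = ≉0-num (*ₚ-≉0 (num≉0 x x≉0) (num≉0 y y≉0))

÷-nonZero : ∀ {x y} → NonZero x → (y≉0 : NonZero y) → NonZero (_÷_ x y {{y≉0}})
÷-nonZero {x} {y} x≉0 _ = ≉0-num (*ₚ-≉0 (num≉0 x x≉0) (den≉0 y))

1-nonZero : NonZero 1#
1-nonZero = ≉0-num 1ₚ≉0

^-nonZero : ∀ {x} → NonZero x → ∀ n → NonZero (x ^ n)
^-nonZero x≉0 zero    = 1-nonZero
^-nonZero x≉0 (suc n) = *-nonZero x≉0 (^-nonZero x≉0 n)

instance
  q-nonZero : NonZero q
  q-nonZero = ≉0-num (λ eq → ℚ.1≢0 (eq .at 1))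

-- A sufficient condition for x to be regular at q = 0 with value v.
record At0 (x : ℚ⟨q⟩) (v : ℚ) : Set where
  constructor _,_
  field
    num₀ : coeff (num x) 0 ≡ v
    den₀ : coeff (den x) 0 ≡ 1ℚ

at0-nonZero : ∀ {x v} → v ≢ 0ℚ → At0 x v → NonZero x
at0-nonZero v≢0 (n , _) = ≉0-num λ eq → v≢0 (trans (sym n) (eq .at 0))

at0-* : ∀ {x y v w} → At0 x v → At0 y w → At0 (x * y) (v ℚ.* w)
at0-* {x} {y} (n , d) (n′ , d′) =
  trans (coeff-*-zero (num x) (num y)) (cong₂ ℚ._*_ n n′) ,
  trans (coeff-*-zero (den x) (den y)) (cong₂ ℚ._*_ d d′)

at0-+ : ∀ {x y v w} → At0 x v → At0 y w → At0 (x + y) (v ℚ.+ w)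
at0-+ {x} {y} {v} {w} (n , d) (n′ , d′) =
  trans (coeff-+ (num x *ₚ den y) (num y *ₚ den x) 0) (cong₂ ℚ._+_
    (trans (coeff-*-zero (num x) (den y)) (trans (cong₂ ℚ._*_ n d′) (ℚ.*-identityʳ v)))
    (trans (coeff-*-zero (num y) (den x)) (trans (cong₂ ℚ._*_ n′ d) (ℚ.*-identityʳ w)))) ,
  trans (coeff-*-zero (den x) (den y)) (cong₂ ℚ._*_ d d′)

at0-neg : ∀ {x v} → At0 x v → At0 (- x) (ℚ.- v)
at0-neg {x} (n , d) = trans (coeff-neg (num x) 0) (cong (λ a → ℚ.- a) n) , d

at0-1 : At0 1# 1ℚ
at0-1 = refl , refl

at0-q : At0 q 0ℚ
at0-q = refl , refl

at0-*-vanishes : ∀ {x y v} → At0 x 0ℚ → At0 y v → At0 (x * y) 0ℚ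
at0-*-vanishes {v = v} x₀ y₀ = subst (At0 _) (ℚ.*-zeroˡ v) (at0-* x₀ y₀)

at0-^ : ∀ {x} → At0 x 0ℚ → ∀ n → At0 (x ^ suc n) 0ℚ
at0-^ x₀ zero    = at0-*-vanishes x₀ at0-1
at0-^ x₀ (suc n) = at0-*-vanishes x₀ (at0-^ x₀ n)

infixr 8 _^ᶻ_

_^ᶻ_ : (x : ℚ⟨q⟩) (e : ℤ) .{{_ : NonZero x}} → ℚ⟨q⟩
x ^ᶻ (+ n) = x ^ n
_^ᶻ_ x -[1+ n ] {{x≉0}} = _÷_ 1# (x ^ suc n) {{^-nonZero x≉0 (suc n)}}

∑< : ℕ → (ℕ → ℚ⟨q⟩) → ℚ⟨q⟩
∑< n f = sum {n} (λ k → f (toℕ k))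

infixr 5 ∑<
syntax ∑< n (λ k → e) = ∑[ k < n ] e

-- ⟨ a ⨾ b ⟩ n  is the q-Pochhammer symbol (a ; b)ₙ to base b.
infix 9 ⟨_⨾_⟩_

⟨_⨾_⟩_ : ℚ⟨q⟩ → ℚ⟨q⟩ → ℕ → ℚ⟨q⟩
⟨ a ⨾ b ⟩ n = product {n} (λ j → 1# - a * b ^ toℕ j)

product-at0 : ∀ {n} (f : Fin n → ℚ⟨q⟩) → (∀ j → At0 (f j) 1ℚ) → At0 (product f) 1ℚ
product-at0 {zero}  f f₀ = at0-1
product-at0 {suc n} f f₀ = at0-* {f zero} (f₀ zero) (product-at0 (λ j → f (suc j)) λ j → f₀ (suc j))

⨾-nonZero : ∀ {a b} → At0 a 0ℚ → At0 b 0ℚ → ∀ n → NonZero (⟨ a ⨾ b ⟩ n)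
⨾-nonZero {a} {b} a₀ b₀ n =
  at0-nonZero ℚ.1≢0 (product-at0 _ λ (j : Fin n) → at0-+ at0-1 (at0-neg (a*b^ (toℕ j))))
  where
  a*b^ : ∀ j → At0 (a * b ^ j) 0ℚ
  a*b^ zero    = at0-*-vanishes a₀ at0-1
  a*b^ (suc j) = at0-*-vanishes a₀ (at0-^ b₀ j)

⟨q⨾q⟩-nonZero : ∀ n → NonZero (⟨ q ⨾ q ⟩ n)
⟨q⨾q⟩-nonZero = ⨾-nonZero at0-q at0-q

⟨q²⨾q⟩-nonZero : ∀ n → NonZero (⟨ q ^ 2 ⨾ q ⟩ n)
⟨q²⨾q⟩-nonZero = ⨾-nonZero (at0-^ at0-q 1) at0-q

⟨q²⨾q²⟩-nonZero : ∀ n → NonZero (⟨ q ^ 2 ⨾ q ^ 2 ⟩ n)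
⟨q²⨾q²⟩-nonZero = ⨾-nonZero (at0-^ at0-q 1) (at0-^ at0-q 1)

q^[1+n]-1-nonZero : ∀ n → NonZero (q ^ suc n - 1#)
q^[1+n]-1-nonZero n = at0-nonZero (λ ()) (at0-+ (at0-^ at0-q n) (at0-neg at0-1))

-- The q-binomial coefficient; only meaningful for k ≤ n.
qbinom : ℕ → ℕ → ℚ⟨q⟩
qbinom n k = (⟨ q ⨾ q ⟩ n ÷ (⟨ q ⨾ q ⟩ k * ⟨ q ⨾ q ⟩ (n ℕ.∸ k)))
  {{*-nonZero (⟨q⨾q⟩-nonZero k) (⟨q⨾q⟩-nonZero (n ℕ.∸ k))}}

qbinom-nonZero : ∀ n k → NonZero (qbinom n k)
qbinom-nonZero n k = ÷-nonZero (⟨q⨾q⟩-nonZero n)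
  (*-nonZero (⟨q⨾q⟩-nonZero k) (⟨q⨾q⟩-nonZero (n ℕ.∸ k)))

-- Every numerator halved below is even, so the integer division is exact.
C : ℕ → ℚ⟨q⟩
C i = ((
    q ^ᶻ (I ℤ.+ + 1)
  + q ^ᶻ (+ 3 ℤ.* (I ℤ.+ + 1))
  + q ^ᶻ (ℤ.- (I ℤ.* (I ℤ.- + 1)) ℤ./ + 2)
  + q ^ᶻ (ℤ.- ((I ℤ.+ + 1) ℤ.* (I ℤ.- + 4)) ℤ./ + 2)
  - q ^ᶻ ((+ 2 ℤ.+ + 3 ℤ.* I ℤ.- I ℤ.* I) ℤ./ + 2)
  - q ^ᶻ (ℤ.- ((I ℤ.+ + 1) ℤ.* (I ℤ.- + 2)) ℤ./ + 2)
  - 2 × q ^ᶻ (+ 2 ℤ.* (I ℤ.+ + 1))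
  ) ÷ (q ^ suc i - 1#)) {{q^[1+n]-1-nonZero i}}
  where
  I : ℤ
  I = + i

{-# OPTIONS --safe #-}
module Submission where

-- With t(n,k) = q^(-k(k-1)/2) / [n,k], one has
--   (1 - q^(n+1)) (t(n+1,k) + q^(n+1) t(n+1,k+1)) = (1 - q^(n+2)) t(n,k).
-- Summing over k < n shows that the left-hand side S(n) satisfies
--   (1 - q^(2n+2)) S(n+1) = (1 - q^(n+2)) S(n) - C(n),
-- because C(n) simplifies to -(q^(-n(n-1)/2) (1 - q) + q^(n+1) (1 - q^(n+1))).
-- The right-hand side visibly satisfies the same recurrence, and both sides vanish at n = 0.

open import Algebra.Bundles using (CommutativeRing)
import Algebra.Properties.Monoid.Sum as MonoidSum
import Algebra.Properties.Ring as RingProperties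
import Algebra.Properties.Semiring.Exp as Exp
import Algebra.Properties.Semiring.Sum as SemiringSum
import Algebra.Solver.Ring as RingSolver
open import Algebra.Solver.Ring.AlmostCommutativeRing using (fromCommutativeRing; _-Raw-AlmostCommutative⟶_)
import Algebra.Solver.Ring.NaturalCoefficients.Default as SemiringSolver
open import Data.Fin.Base using (toℕ)
import Data.Fin.Properties as Fin
open import Data.Integer.Base as ℤ using (ℤ; +_)
open import Data.Integer.DivMod using (div-pos-is-/ℕ)
import Data.Integer.Properties as ℤ
open import Data.Integer.Solver renaming (module +-*-Solver to ℤ-Solver)
open import Data.List.Base using ([]; _∷_)
open import Data.Maybe.Base as Maybe using (Maybe)
open import Data.Nat.Base as ℕ using (ℕ; suc)
open import Data.Nat.DivMod using (m*n/n≡m; m*n%n≡0)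
import Data.Nat.Properties as ℕ
open import Data.Product.Base using (_,_)
open import Data.Rational.Base as ℚ using (ℚ; 0ℚ; 1ℚ)
import Data.Rational.Properties as ℚ
open import Data.Sum.Base using ([_,_]′)
open import Function.Base using (_∘_)
open import Level using (0ℓ)
open import Relation.Binary.Bundles using (Setoid)
open import Relation.Binary.Consequences using (dec⇒weaklyDec)
open import Relation.Binary.PropositionalEquality as ≡ using (_≡_; cong; cong₂)
import Relation.Binary.Reasoning.Setoid as SetoidReasoning
open import Relation.Binary.Structures using (IsEquivalence)
open import Relation.Nullary using (contradiction)

open import Defs

-- The ring of polynomials

private
  variable
    a b : ℚ
    p p′ r r′ : ℚ[q]

≈ₚ-refl : p ≈ₚ p
≈ₚ-refl .at i = ≡.refl

≈ₚ-isEquivalence : IsEquivalence _≈ₚ_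
≈ₚ-isEquivalence = record { refl = ≈ₚ-refl ; sym = ≈ₚ-sym ; trans = ≈ₚ-trans }

≈ₚ-setoid : Setoid 0ℓ 0ℓ
≈ₚ-setoid = record { isEquivalence = ≈ₚ-isEquivalence }

∷-cong : a ≡ b → p ≈ₚ r → a ∷ p ≈ₚ b ∷ r
∷-cong a≡b p≈r .at ℕ.zero  = a≡b
∷-cong a≡b p≈r .at (suc i) = p≈r .at i

head-≈ : a ∷ p ≈ₚ b ∷ r → a ≡ b
head-≈ eq = eq .at 0

tail-≈ : a ∷ p ≈ₚ b ∷ r → p ≈ₚ r
tail-≈ eq .at i = eq .at (suc i)

+ₚ-cong : p ≈ₚ p′ → r ≈ₚ r′ → p +ₚ r ≈ₚ p′ +ₚ r′
+ₚ-cong {p} {p′} {r} {r′} p≈p′ r≈r′ .at i = begin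
  coeff (p +ₚ r) i           ≡⟨ coeff-+ p r i ⟩
  coeff p i ℚ.+ coeff r i    ≡⟨ cong₂ ℚ._+_ (p≈p′ .at i) (r≈r′ .at i) ⟩
  coeff p′ i ℚ.+ coeff r′ i  ≡⟨ coeff-+ p′ r′ i ⟨
  coeff (p′ +ₚ r′) i         ∎
  where open ≡.≡-Reasoning

+ₚ-comm : ∀ p r → p +ₚ r ≈ₚ r +ₚ p
+ₚ-comm p r .at i = begin
  coeff (p +ₚ r) i         ≡⟨ coeff-+ p r i ⟩
  coeff p i ℚ.+ coeff r i  ≡⟨ ℚ.+-comm (coeff p i) (coeff r i) ⟩
  coeff r i ℚ.+ coeff p i  ≡⟨ coeff-+ r p i ⟨
  coeff (r +ₚ p) i         ∎
  where open ≡.≡-Reasoning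

+ₚ-assoc : ∀ p r s → (p +ₚ r) +ₚ s ≈ₚ p +ₚ (r +ₚ s)
+ₚ-assoc []      r       s       = ≈ₚ-refl
+ₚ-assoc (a ∷ p) []      s       = ≈ₚ-refl
+ₚ-assoc (a ∷ p) (b ∷ r) []      = ≈ₚ-refl
+ₚ-assoc (a ∷ p) (b ∷ r) (c ∷ s) = ∷-cong (ℚ.+-assoc a b c) (+ₚ-assoc p r s)

+ₚ-identityʳ : ∀ p → p +ₚ 0ₚ ≈ₚ p
+ₚ-identityʳ []      = ≈ₚ-refl
+ₚ-identityʳ (a ∷ p) = ≈ₚ-refl

-ₚ-inverseʳ : ∀ p → p +ₚ (-ₚ p) ≈ₚ 0ₚ
-ₚ-inverseʳ []      = ≈ₚ-refl
-ₚ-inverseʳ (a ∷ p) = ∷-≈0 (ℚ.+-inverseʳ a) (-ₚ-inverseʳ p)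

-ₚ-cong : p ≈ₚ r → -ₚ p ≈ₚ -ₚ r
-ₚ-cong {p} {r} p≈r .at i =
  ≡.trans (coeff-neg p i) (≡.trans (cong (λ a → ℚ.- a) (p≈r .at i)) (≡.sym (coeff-neg r i)))

+ₚ-interchange : ∀ p r p′ r′ → (p +ₚ r) +ₚ (p′ +ₚ r′) ≈ₚ (p +ₚ p′) +ₚ (r +ₚ r′)
+ₚ-interchange p r p′ r′ = begin
  (p +ₚ r) +ₚ (p′ +ₚ r′)  ≈⟨ +ₚ-assoc p r (p′ +ₚ r′) ⟩
  p +ₚ (r +ₚ (p′ +ₚ r′))  ≈⟨ +ₚ-cong (≈ₚ-refl {p}) (+ₚ-assoc r p′ r′) ⟨
  p +ₚ ((r +ₚ p′) +ₚ r′)  ≈⟨ +ₚ-cong (≈ₚ-refl {p}) (+ₚ-cong (+ₚ-comm r p′) ≈ₚ-refl) ⟩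
  p +ₚ ((p′ +ₚ r) +ₚ r′)  ≈⟨ +ₚ-cong (≈ₚ-refl {p}) (+ₚ-assoc p′ r r′) ⟩
  p +ₚ (p′ +ₚ (r +ₚ r′))  ≈⟨ +ₚ-assoc p p′ (r +ₚ r′) ⟨
  (p +ₚ p′) +ₚ (r +ₚ r′)  ∎
  where open SetoidReasoning ≈ₚ-setoid

·ₚ-cong : a ≡ b → p ≈ₚ r → a ·ₚ p ≈ₚ b ·ₚ r
·ₚ-cong {a} {b} {p} {r} a≡b p≈r .at i =
  ≡.trans (coeff-· a p i) (≡.trans (cong₂ ℚ._*_ a≡b (p≈r .at i)) (≡.sym (coeff-· b r i)))

·ₚ-distribˡ : ∀ a p r → a ·ₚ (p +ₚ r) ≈ₚ a ·ₚ p +ₚ a ·ₚ r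
·ₚ-distribˡ a []      r       = ≈ₚ-refl
·ₚ-distribˡ a (b ∷ p) []      = ≈ₚ-refl
·ₚ-distribˡ a (b ∷ p) (c ∷ r) = ∷-cong (ℚ.*-distribˡ-+ a b c) (·ₚ-distribˡ a p r)

·ₚ-distribʳ : ∀ a b p → (a ℚ.+ b) ·ₚ p ≈ₚ a ·ₚ p +ₚ b ·ₚ p
·ₚ-distribʳ a b []      = ≈ₚ-refl
·ₚ-distribʳ a b (c ∷ p) = ∷-cong (ℚ.*-distribʳ-+ c a b) (·ₚ-distribʳ a b p)

·ₚ-assoc : ∀ a b p → (a ℚ.* b) ·ₚ p ≈ₚ a ·ₚ (b ·ₚ p)
·ₚ-assoc a b []      = ≈ₚ-refl
·ₚ-assoc a b (c ∷ p) = ∷-cong (ℚ.*-assoc a b c) (·ₚ-assoc a b p)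

·ₚ-identity : ∀ p → 1ℚ ·ₚ p ≈ₚ p
·ₚ-identity []      = ≈ₚ-refl
·ₚ-identity (a ∷ p) = ∷-cong (ℚ.*-identityˡ a) (·ₚ-identity p)

*ₚ-congˡ : ∀ p → r ≈ₚ r′ → p *ₚ r ≈ₚ p *ₚ r′
*ₚ-congˡ []      r≈r′ = ≈ₚ-refl
*ₚ-congˡ (a ∷ p) r≈r′ = +ₚ-cong (·ₚ-cong {a} ≡.refl r≈r′) (∷-cong ≡.refl (*ₚ-congˡ p r≈r′))

-- Lists of different lengths can represent the same polynomial. Once one list runs out, the other
-- consists of zeros only, and `*ₚ-zeroˡ` makes its product vanish.
*ₚ-congʳ : ∀ p p′ r → p ≈ₚ p′ → p *ₚ r ≈ₚ p′ *ₚ r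
*ₚ-congʳ []      p′       r p≈p′ = ≈ₚ-sym (*ₚ-zeroˡ p′ r (≈ₚ-sym p≈p′))
*ₚ-congʳ (a ∷ p) []       r p≈p′ = *ₚ-zeroˡ (a ∷ p) r p≈p′
*ₚ-congʳ (a ∷ p) (b ∷ p′) r p≈p′ =
  +ₚ-cong (·ₚ-cong (head-≈ p≈p′) ≈ₚ-refl) (∷-cong ≡.refl (*ₚ-congʳ p p′ r (tail-≈ p≈p′)))

*ₚ-cong : p ≈ₚ p′ → r ≈ₚ r′ → p *ₚ r ≈ₚ p′ *ₚ r′
*ₚ-cong {p} {p′} {r} p≈p′ r≈r′ = ≈ₚ-trans (*ₚ-congʳ p p′ r p≈p′) (*ₚ-congˡ p′ r≈r′)

*ₚ-distribʳ : ∀ s p r → (p +ₚ r) *ₚ s ≈ₚ p *ₚ s +ₚ r *ₚ s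
*ₚ-distribʳ s []      r       = ≈ₚ-refl
*ₚ-distribʳ s (a ∷ p) []      = ≈ₚ-sym (+ₚ-identityʳ ((a ∷ p) *ₚ s))
*ₚ-distribʳ s (a ∷ p) (b ∷ r) = begin
  (a ℚ.+ b) ·ₚ s +ₚ (0ℚ ∷ (p +ₚ r) *ₚ s)
    ≈⟨ +ₚ-cong (·ₚ-distribʳ a b s) (∷-cong ≡.refl (*ₚ-distribʳ s p r)) ⟩
  (a ·ₚ s +ₚ b ·ₚ s) +ₚ ((0ℚ ∷ p *ₚ s) +ₚ (0ℚ ∷ r *ₚ s))
    ≈⟨ +ₚ-interchange (a ·ₚ s) (b ·ₚ s) (0ℚ ∷ p *ₚ s) (0ℚ ∷ r *ₚ s) ⟩
  (a ∷ p) *ₚ s +ₚ (b ∷ r) *ₚ s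
    ∎
  where open SetoidReasoning ≈ₚ-setoid

·ₚ-*ₚ-assoc : ∀ a r s → (a ·ₚ r) *ₚ s ≈ₚ a ·ₚ (r *ₚ s)
·ₚ-*ₚ-assoc a []      s = ≈ₚ-refl
·ₚ-*ₚ-assoc a (b ∷ r) s = begin
  (a ℚ.* b) ·ₚ s +ₚ (0ℚ ∷ (a ·ₚ r) *ₚ s)
    -- Rewriting the constant term 0 of the shifted part as `a ℚ.* 0ℚ` lets the scalar `a` be
    -- factored out of both summands.
    ≈⟨ +ₚ-cong (·ₚ-assoc a b s) (∷-cong (≡.sym (ℚ.*-zeroʳ a)) (·ₚ-*ₚ-assoc a r s)) ⟩
  a ·ₚ (b ·ₚ s) +ₚ a ·ₚ (0ℚ ∷ r *ₚ s)
    ≈⟨ ·ₚ-distribˡ a (b ·ₚ s) (0ℚ ∷ r *ₚ s) ⟨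
  a ·ₚ ((b ∷ r) *ₚ s)
    ∎
  where open SetoidReasoning ≈ₚ-setoid

*ₚ-assoc : ∀ p r s → (p *ₚ r) *ₚ s ≈ₚ p *ₚ (r *ₚ s)
*ₚ-assoc []      r s = ≈ₚ-refl
*ₚ-assoc (a ∷ p) r s = begin
  (a ·ₚ r +ₚ (0ℚ ∷ p *ₚ r)) *ₚ s
    ≈⟨ *ₚ-distribʳ s (a ·ₚ r) (0ℚ ∷ p *ₚ r) ⟩
  (a ·ₚ r) *ₚ s +ₚ (0ℚ ∷ p *ₚ r) *ₚ s
    ≈⟨ +ₚ-cong (·ₚ-*ₚ-assoc a r s) (0∷-*ₚ ≡.refl (p *ₚ r) s) ⟩
  a ·ₚ (r *ₚ s) +ₚ (0ℚ ∷ (p *ₚ r) *ₚ s)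
    ≈⟨ +ₚ-cong ≈ₚ-refl (∷-cong ≡.refl (*ₚ-assoc p r s)) ⟩
  (a ∷ p) *ₚ (r *ₚ s)
    ∎
  where open SetoidReasoning ≈ₚ-setoid

*ₚ-zeroʳ : ∀ p → p *ₚ 0ₚ ≈ₚ 0ₚ
*ₚ-zeroʳ []      = ≈ₚ-refl
*ₚ-zeroʳ (a ∷ p) = ∷-≈0 ≡.refl (*ₚ-zeroʳ p)

-- `_*ₚ_` recurses on its left factor; this is the mirror expansion along the right factor, which is
-- what the induction for `*ₚ-comm` needs.
*ₚ-∷ : ∀ p b r → p *ₚ (b ∷ r) ≈ₚ b ·ₚ p +ₚ (0ℚ ∷ p *ₚ r)
*ₚ-∷ []      b r = ≈ₚ-sym (∷-≈0 ≡.refl ≈ₚ-refl)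
*ₚ-∷ (a ∷ p) b r = ∷-cong (cong (ℚ._+ 0ℚ) (ℚ.*-comm a b)) (begin
  a ·ₚ r +ₚ p *ₚ (b ∷ r)                ≈⟨ +ₚ-cong (≈ₚ-refl {a ·ₚ r}) (*ₚ-∷ p b r) ⟩
  a ·ₚ r +ₚ (b ·ₚ p +ₚ (0ℚ ∷ p *ₚ r))   ≈⟨ +ₚ-assoc (a ·ₚ r) (b ·ₚ p) (0ℚ ∷ p *ₚ r) ⟨
  (a ·ₚ r +ₚ b ·ₚ p) +ₚ (0ℚ ∷ p *ₚ r)   ≈⟨ +ₚ-cong (+ₚ-comm (a ·ₚ r) (b ·ₚ p)) ≈ₚ-refl ⟩
  (b ·ₚ p +ₚ a ·ₚ r) +ₚ (0ℚ ∷ p *ₚ r)   ≈⟨ +ₚ-assoc (b ·ₚ p) (a ·ₚ r) (0ℚ ∷ p *ₚ r) ⟩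
  b ·ₚ p +ₚ (a ∷ p) *ₚ r                ∎)
  where open SetoidReasoning ≈ₚ-setoid

*ₚ-comm : ∀ p r → p *ₚ r ≈ₚ r *ₚ p
*ₚ-comm []      r = ≈ₚ-sym (*ₚ-zeroʳ r)
*ₚ-comm (a ∷ p) r = ≈ₚ-trans
  (+ₚ-cong ≈ₚ-refl (∷-cong ≡.refl (*ₚ-comm p r))) (≈ₚ-sym (*ₚ-∷ r a p))

*ₚ-identityˡ : ∀ p → 1ₚ *ₚ p ≈ₚ p
*ₚ-identityˡ p = ≈ₚ-trans
  (+ₚ-cong (·ₚ-identity p) (∷-≈0 ≡.refl ≈ₚ-refl)) (+ₚ-identityʳ p)

polynomialRing : CommutativeRing 0ℓ 0ℓ
polynomialRing = record
  { Carrier = ℚ[q] ; _≈_ = _≈ₚ_ ; _+_ = _+ₚ_ ; _*_ = _*ₚ_ ; -_ = -ₚ_ ; 0# = 0ₚ ; 1# = 1ₚ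
  ; isCommutativeRing = record
    { isRing = record
      { +-isAbelianGroup = record
        { isGroup = record
          { isMonoid = record
            { isSemigroup = record
              { isMagma = record { isEquivalence = ≈ₚ-isEquivalence ; ∙-cong = +ₚ-cong }
              ; assoc = +ₚ-assoc
              }
            ; identity = (λ _ → ≈ₚ-refl) , +ₚ-identityʳ
            }
          ; inverse = (λ p → ≈ₚ-trans (+ₚ-comm (-ₚ p) p) (-ₚ-inverseʳ p)) , -ₚ-inverseʳ
          ; ⁻¹-cong = -ₚ-cong
          }
        ; comm = +ₚ-comm
        }
      ; *-cong = *ₚ-cong
      ; *-assoc = *ₚ-assoc
      ; *-identity = *ₚ-identityˡ , λ p → ≈ₚ-trans (*ₚ-comm p 1ₚ) (*ₚ-identityˡ p)
      ; distrib = (λ s p r → ≈ₚ-trans (*ₚ-comm s (p +ₚ r)) (≈ₚ-trans (*ₚ-distribʳ s p r)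
                                 (+ₚ-cong (*ₚ-comm p s) (*ₚ-comm r s))))
                , *ₚ-distribʳ
      }
    ; *-comm = *ₚ-comm
    }
  }

module ℚ[q] = CommutativeRing polynomialRing
module ℚ[q]-Properties = RingProperties ℚ[q].ring
module ℚ[q]-Solver = SemiringSolver ℚ[q].commutativeSemiring

*ₚ-swapʳ : ∀ p r s → (p *ₚ r) *ₚ s ≈ₚ (p *ₚ s) *ₚ r
*ₚ-swapʳ = solve 3 (λ p r s → (p :* r) :* s := (p :* s) :* r) ≈ₚ-refl
  where open ℚ[q]-Solver

*ₚ-interchange : ∀ p r p′ r′ → (p *ₚ r) *ₚ (p′ *ₚ r′) ≈ₚ (p *ₚ p′) *ₚ (r *ₚ r′)
*ₚ-interchange = solve 4 (λ p r p′ r′ → (p :* r) :* (p′ :* r′) := (p :* p′) :* (r :* r′)) ≈ₚ-refl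
  where open ℚ[q]-Solver

-- The difference `p - r` is annihilated by `s`, so the absence of zero divisors (`*ₚ-domain`)
-- forces it to be zero.
*ₚ-cancelʳ : ∀ p r s → s ≉ₚ 0ₚ → p *ₚ s ≈ₚ r *ₚ s → p ≈ₚ r
*ₚ-cancelʳ p r s s≉0 ps≈rs =
  [ ℚ[q]-Properties.x∙y⁻¹≈ε⇒x≈y p r , (λ s≈0 → contradiction s≈0 s≉0) ]′
  (*ₚ-domain (p ℚ[q].- r) s (begin
    (p ℚ[q].- r) *ₚ s         ≈⟨ ℚ[q]-Properties.[y-z]x≈yx-zx s p r ⟩
    p *ₚ s ℚ[q].- r *ₚ s      ≈⟨ +ₚ-cong ps≈rs ≈ₚ-refl ⟩
    r *ₚ s ℚ[q].- r *ₚ s      ≈⟨ -ₚ-inverseʳ (r *ₚ s) ⟩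
    0ₚ                        ∎))
  where open SetoidReasoning ≈ₚ-setoid

-- The field of rational functions

≈-refl : ∀ {x} → x ≈ x
≈-refl = cross ≈ₚ-refl

≈-sym : ∀ {x y} → x ≈ y → y ≈ x
≈-sym (cross eq) = cross (≈ₚ-sym eq)

-- Chaining the two cross-multiplied equations leaves a spare factor `den y` on both sides, which is
-- nonzero and cancels.
≈-trans : ∀ {x y z} → x ≈ y → y ≈ z → x ≈ z
≈-trans {x} {y} {z} (cross x≈y) (cross y≈z) = cross (*ₚ-cancelʳ _ _ (den y) (den≉0 y) (begin
  (num x *ₚ den z) *ₚ den y  ≈⟨ *ₚ-swapʳ (num x) (den z) (den y) ⟩
  (num x *ₚ den y) *ₚ den z  ≈⟨ *ₚ-cong x≈y ≈ₚ-refl ⟩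
  (num y *ₚ den x) *ₚ den z  ≈⟨ *ₚ-swapʳ (num y) (den x) (den z) ⟩
  (num y *ₚ den z) *ₚ den x  ≈⟨ *ₚ-cong y≈z ≈ₚ-refl ⟩
  (num z *ₚ den y) *ₚ den x  ≈⟨ *ₚ-swapʳ (num z) (den y) (den x) ⟩
  (num z *ₚ den x) *ₚ den y  ∎))
  where open SetoidReasoning ≈ₚ-setoid

≈-isEquivalence : IsEquivalence _≈_
≈-isEquivalence = record { refl = ≈-refl ; sym = ≈-sym ; trans = ≈-trans }

+-cong : ∀ {x x′ y y′} → x ≈ x′ → y ≈ y′ → x + y ≈ x′ + y′
+-cong {x} {x′} {y} {y′} (cross x≈x′) (cross y≈y′) = cross (begin
  (num x *ₚ den y +ₚ num y *ₚ den x) *ₚ (den x′ *ₚ den y′)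
    ≈⟨ solve 6 (λ a b c d e f → (a :* d :+ c :* b) :* (e :* f) := (a :* e) :* (d :* f) :+ (c :* f) :* (b :* e))
         ≈ₚ-refl (num x) (den x) (num y) (den y) (den x′) (den y′) ⟩
  (num x *ₚ den x′) *ₚ (den y *ₚ den y′) +ₚ (num y *ₚ den y′) *ₚ (den x *ₚ den x′)
    ≈⟨ +ₚ-cong (*ₚ-cong x≈x′ ≈ₚ-refl) (*ₚ-cong y≈y′ ≈ₚ-refl) ⟩
  (num x′ *ₚ den x) *ₚ (den y *ₚ den y′) +ₚ (num y′ *ₚ den y) *ₚ (den x *ₚ den x′)
    ≈⟨ solve 6 (λ a b c d e f → (a :* e) :* (f :* d) :+ (c :* f) :* (e :* b) := (a :* d :+ c :* b) :* (e :* f))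
         ≈ₚ-refl (num x′) (den x′) (num y′) (den y′) (den x) (den y) ⟩
  (num x′ *ₚ den y′ +ₚ num y′ *ₚ den x′) *ₚ (den x *ₚ den y)
    ∎)
  where
  open SetoidReasoning ≈ₚ-setoid
  open ℚ[q]-Solver

*-cong : ∀ {x x′ y y′} → x ≈ x′ → y ≈ y′ → x * y ≈ x′ * y′
*-cong {x} {x′} {y} {y′} (cross x≈x′) (cross y≈y′) = cross (begin
  (num x *ₚ num y) *ₚ (den x′ *ₚ den y′)   ≈⟨ *ₚ-interchange (num x) (num y) (den x′) (den y′) ⟩
  (num x *ₚ den x′) *ₚ (num y *ₚ den y′)   ≈⟨ *ₚ-cong x≈x′ y≈y′ ⟩
  (num x′ *ₚ den x) *ₚ (num y′ *ₚ den y)   ≈⟨ *ₚ-interchange (num x′) (den x) (num y′) (den y) ⟩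
  (num x′ *ₚ num y′) *ₚ (den x *ₚ den y)   ∎)
  where open SetoidReasoning ≈ₚ-setoid

-‿cong : ∀ {x y} → x ≈ y → - x ≈ - y
-‿cong {x} {y} (cross eq) = cross (begin
  (-ₚ num x) *ₚ den y   ≈⟨ -‿distribˡ-* (num x) (den y) ⟨
  -ₚ (num x *ₚ den y)   ≈⟨ -ₚ-cong eq ⟩
  -ₚ (num y *ₚ den x)   ≈⟨ -‿distribˡ-* (num y) (den x) ⟩
  (-ₚ num y) *ₚ den x   ∎)
  where
  open SetoidReasoning ≈ₚ-setoid
  open ℚ[q]-Properties

≈0 : ∀ {x} → num x ≈ₚ 0ₚ → x ≈ 0#
≈0 {x} n≈0 = cross (*ₚ-zeroˡ (num x) 1ₚ n≈0)

-‿inverseʳ : ∀ x → x - x ≈ 0#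
-‿inverseʳ x = ≈0 (begin
  num x *ₚ den x +ₚ (-ₚ num x) *ₚ den x   ≈⟨ *ₚ-distribʳ (den x) (num x) (-ₚ num x) ⟨
  (num x +ₚ (-ₚ num x)) *ₚ den x          ≈⟨ *ₚ-zeroˡ _ (den x) (-ₚ-inverseʳ (num x)) ⟩
  0ₚ                                      ∎)
  where open SetoidReasoning ≈ₚ-setoid

+-comm : ∀ x y → x + y ≈ y + x
+-comm x y = cross (solve 4
  (λ a b c d → (a :* d :+ c :* b) :* (d :* b) := (c :* b :+ a :* d) :* (b :* d))
  ≈ₚ-refl (num x) (den x) (num y) (den y))
  where open ℚ[q]-Solver

+-assoc : ∀ x y z → (x + y) + z ≈ x + (y + z)
+-assoc x y z = cross (solve 6
  (λ a b c d e f → ((a :* d :+ c :* b) :* f :+ e :* (b :* d)) :* (b :* (d :* f))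
                := (a :* (d :* f) :+ (c :* f :+ e :* d) :* b) :* ((b :* d) :* f))
  ≈ₚ-refl (num x) (den x) (num y) (den y) (num z) (den z))
  where open ℚ[q]-Solver

+-identityʳ : ∀ x → x + 0# ≈ x
+-identityʳ x = cross (begin
  (num x *ₚ 1ₚ +ₚ 0ₚ) *ₚ den x   ≈⟨ *ₚ-cong (+ₚ-identityʳ (num x *ₚ 1ₚ)) ≈ₚ-refl ⟩
  (num x *ₚ 1ₚ) *ₚ den x         ≈⟨ solve 3 (λ a b c → (a :* b) :* c := a :* (c :* b)) ≈ₚ-refl (num x) 1ₚ (den x) ⟩
  num x *ₚ (den x *ₚ 1ₚ)         ∎)
  where
  open SetoidReasoning ≈ₚ-setoid
  open ℚ[q]-Solver

*-comm : ∀ x y → x * y ≈ y * x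
*-comm x y = cross (solve 4 (λ a b c d → (a :* c) :* (d :* b) := (c :* a) :* (b :* d))
  ≈ₚ-refl (num x) (den x) (num y) (den y))
  where open ℚ[q]-Solver

*-assoc : ∀ x y z → (x * y) * z ≈ x * (y * z)
*-assoc x y z = cross (*ₚ-cong (*ₚ-assoc (num x) (num y) (num z)) (≈ₚ-sym (*ₚ-assoc (den x) (den y) (den z))))

*-identityʳ : ∀ x → x * 1# ≈ x
*-identityʳ x = cross (solve 3 (λ a b c → (a :* b) :* c := a :* (c :* b)) ≈ₚ-refl (num x) 1ₚ (den x))
  where open ℚ[q]-Solver

*-distribʳ : ∀ z x y → (x + y) * z ≈ x * z + y * z
*-distribʳ z x y = cross (solve 6
  (λ a b c d e f → ((a :* d :+ c :* b) :* e) :* ((b :* f) :* (d :* f))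
                := ((a :* e) :* (d :* f) :+ (c :* e) :* (b :* f)) :* ((b :* d) :* f))
  ≈ₚ-refl (num x) (den x) (num y) (den y) (num z) (den z))
  where open ℚ[q]-Solver

rationalFunctionRing : CommutativeRing 0ℓ 0ℓ
rationalFunctionRing = record
  { Carrier = ℚ⟨q⟩ ; _≈_ = _≈_ ; _+_ = _+_ ; _*_ = _*_ ; -_ = -_ ; 0# = 0# ; 1# = 1#
  ; isCommutativeRing = record
    { isRing = record
      { +-isAbelianGroup = record
        { isGroup = record
          { isMonoid = record
            { isSemigroup = record
              { isMagma = record { isEquivalence = ≈-isEquivalence ; ∙-cong = +-cong }
              ; assoc = +-assoc
              }
            ; identity = (λ x → ≈-trans (+-comm 0# x) (+-identityʳ x)) , +-identityʳ
            }
          ; inverse = (λ x → ≈-trans (+-comm (- x) x) (-‿inverseʳ x)) , -‿inverseʳ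
          ; ⁻¹-cong = -‿cong
          }
        ; comm = +-comm
        }
      ; *-cong = *-cong
      ; *-assoc = *-assoc
      ; *-identity = (λ x → ≈-trans (*-comm 1# x) (*-identityʳ x)) , *-identityʳ
      ; distrib = (λ z x y → ≈-trans (*-comm z (x + y)) (≈-trans (*-distribʳ z x y)
                                 (+-cong (*-comm x z) (*-comm y z))))
                , *-distribʳ
      }
    ; *-comm = *-comm
    }
  }

module ℚ⟨q⟩-Ring = CommutativeRing rationalFunctionRing
open ℚ⟨q⟩-Ring
  using (setoid; reflexive; semiring; +-monoid; *-monoid; +-congˡ; +-congʳ; *-congˡ; *-congʳ; *-identityˡ; zeroʳ)
open RingProperties ℚ⟨q⟩-Ring.ring using (-‿involutive)
open Exp semiring using (^-homo-*; ^-assocʳ)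
open SemiringSum semiring using (*-distribˡ-sum; ∑-distrib-+)
open MonoidSum +-monoid using (sum-cong-≋; sum-init-last)
open SetoidReasoning setoid

-- Ring solving and clearing of denominators

constant : ℚ → ℚ⟨q⟩
constant a = fromPoly (a ∷ [])

-- Rational constants serve as solver coefficients: with `constant-≟` deciding their equality,
-- opposite terms cancel, and `con 1ℚ` evaluates to `1#` itself.
constant-homomorphism : ℚ.+-*-rawRing -Raw-AlmostCommutative⟶ fromCommutativeRing rationalFunctionRing
constant-homomorphism = record
  { ⟦_⟧    = constant
  ; +-homo = λ a b → cross (solve 3 (λ p r o → (p :+ r) :* (o :* o) := (p :* o :+ r :* o) :* o)
                              ≈ₚ-refl (a ∷ []) (b ∷ []) 1ₚ)
  ; *-homo = λ a b → cross (*ₚ-cong (∷-cong (≡.sym (ℚ.+-identityʳ (a ℚ.* b))) (≈ₚ-refl {[]})) (*ₚ-identityˡ 1ₚ))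
  ; -‿homo = λ a → cross ≈ₚ-refl
  ; 0-homo = ≈0 (∷-≈0 ≡.refl ≈ₚ-refl)
  ; 1-homo = cross ≈ₚ-refl
  }
  where open ℚ[q]-Solver

constant-≟ : ∀ a b → Maybe (constant a ≈ constant b)
constant-≟ a b = Maybe.map (reflexive ∘ cong constant) (dec⇒weaklyDec ℚ._≟_ a b)

module ℚ⟨q⟩-Solver = RingSolver ℚ.+-*-rawRing (fromCommutativeRing rationalFunctionRing)
  constant-homomorphism constant-≟

-- Both cross products acquire the same factor `num z *ₚ den z`, which is nonzero. Together with
-- `÷-*-cancel` this is how every division below is eliminated.
*-cancelʳ : ∀ {x y} z → NonZero z → x * z ≈ y * z → x ≈ y
*-cancelʳ {x} {y} z z≉0 (cross eq) =
  cross (*ₚ-cancelʳ _ _ (num z *ₚ den z) (*ₚ-≉0 (num≉0 z z≉0) (den≉0 z))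
    (≈ₚ-trans (*ₚ-interchange (num x) (den y) (num z) (den z))
      (≈ₚ-trans eq (≈ₚ-sym (*ₚ-interchange (num y) (den x) (num z) (den z))))))

÷-*-cancel : ∀ x y .{{_ : NonZero y}} → (x ÷ y) * y ≈ x
÷-*-cancel x y = cross (solve 4 (λ a b c d → ((a :* d) :* c) :* b := a :* ((b :* c) :* d))
  ≈ₚ-refl (num x) (den x) (num y) (den y))
  where open ℚ[q]-Solver

-- Finite sums and q-Pochhammer symbols

-- The bound on the index is passed to the termwise hypothesis because `t[]-recurrence` assumes
-- `k ≤ n`.
∑-cong : ∀ n {f g : ℕ → ℚ⟨q⟩} → (∀ k → k ℕ.< n → f k ≈ g k) → ∑< n f ≈ ∑< n g
∑-cong n f≈g = sum-cong-≋ {n} λ k → f≈g (toℕ k) (Fin.toℕ<n k)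


-- Sums unfold from their first term by definition, whereas induction on the upper limit has to
-- split off the last one. `⨾-suc` does the same for products, read as sums in the multiplicative
-- monoid.
∑-last : ∀ n f → ∑< (suc n) f ≈ ∑< n f + f n
∑-last n f = ≈-trans (sum-init-last {n} (f ∘ toℕ)) (+-cong
  (sum-cong-≋ {n} λ k → reflexive (cong f (Fin.toℕ-inject₁ k)))
  (reflexive (cong f (Fin.toℕ-fromℕ n))))

⨾-suc : ∀ a b n → ⟨ a ⨾ b ⟩ (suc n) ≈ ⟨ a ⨾ b ⟩ n * (1# - a * b ^ n)
⨾-suc a b n = ≈-trans (Product.sum-init-last {n} (factor ∘ toℕ)) (*-cong
  (Product.sum-cong-≋ {n} λ k → reflexive (cong factor (Fin.toℕ-inject₁ k)))
  (reflexive (cong factor (Fin.toℕ-fromℕ n))))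
  where
  module Product = MonoidSum *-monoid
  factor : ℕ → ℚ⟨q⟩
  factor j = 1# - a * b ^ j

-- Integer powers of q

-- Writing an exponent as a difference of naturals covers both signs at once: the power is pinned
-- down by what it becomes after multiplication by `q ^ n`.
^ᶻ-⊖ : ∀ m n → q ^ᶻ (m ℤ.⊖ n) * q ^ n ≈ q ^ m
^ᶻ-⊖ m       ℕ.zero  = *-identityʳ (q ^ m)
^ᶻ-⊖ ℕ.zero  (suc n) = ÷-*-cancel 1# (q ^ suc n) {{^-nonZero q-nonZero (suc n)}}
^ᶻ-⊖ (suc m) (suc n) = begin
  q ^ᶻ (suc m ℤ.⊖ suc n) * (q * q ^ n)
    ≡⟨ cong (λ e → q ^ᶻ e * (q * q ^ n)) (ℤ.[1+m]⊖[1+n]≡m⊖n m n) ⟩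
  q ^ᶻ (m ℤ.⊖ n) * (q * q ^ n)
    ≈⟨ solve 3 (λ x y z → x :* (y :* z) := y :* (x :* z)) ≈-refl (q ^ᶻ (m ℤ.⊖ n)) q (q ^ n) ⟩
  q * (q ^ᶻ (m ℤ.⊖ n) * q ^ n)
    ≈⟨ *-congˡ (^ᶻ-⊖ m n) ⟩
  q * q ^ m
    ∎
  where open ℚ⟨q⟩-Solver

-- Exponents that are halves of even integers

i*2/2≡i : ∀ i → (i ℤ.* + 2) ℤ./ + 2 ≡ i
i*2/2≡i (+ n) = ≡.trans (div-pos-is-/ℕ (+ n ℤ.* + 2) 2)
  (≡.trans (cong (ℤ._/ℕ 2) (≡.sym (ℤ.pos-* n 2))) (cong +_ (m*n/n≡m n 2)))
i*2/2≡i ℤ.-[1+ n ] = ≡.trans (div-pos-is-/ℕ (ℤ.-[1+ n ] ℤ.* + 2) 2) negative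
  where
  negative : (ℤ.-[1+ n ] ℤ.* + 2) ℤ./ℕ 2 ≡ ℤ.-[1+ n ]
  -- Division of a negative integer branches on the remainder; evenness selects the branch without
  -- the rounding correction.
  negative rewrite m*n%n≡0 (suc n) 2 {{_}} = cong (λ m → ℤ.- (+ m)) (m*n/n≡m (suc n) 2)

-- This is n(n-1)/2 without a division; its recursion gives `q ^ triangle (suc k)` as `q ^ k` times
-- `q ^ triangle k`.
triangle : ℕ → ℕ
triangle ℕ.zero  = 0
triangle (suc n) = n ℕ.+ triangle n

triangle*2 : ∀ n → + triangle n ℤ.* + 2 ≡ + n ℤ.* (+ n ℤ.- + 1)
triangle*2 ℕ.zero  = ≡.refl
triangle*2 (suc n) = ≡.trans (ℤ.*-distribʳ-+ (+ 2) (+ n) (+ triangle n))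
  (≡.trans (cong (ℤ._+_ (+ n ℤ.* + 2)) (triangle*2 n))
    (solve 1 (λ n → n :* con (+ 2) :+ n :* (n :- con (+ 1))
                  := (con (+ 1) :+ n) :* (con (+ 1) :+ n :- con (+ 1))) ≡.refl (+ n)))
  where open ℤ-Solver

-- Every halved exponent in the statement has the form m - n(n-1)/2, so it suffices to exhibit its
-- numerator as 2m - n(n-1).
halve : ∀ {z} m n → z ≡ + m ℤ.* + 2 ℤ.- + n ℤ.* (+ n ℤ.- + 1) → z ℤ./ + 2 ≡ m ℤ.⊖ triangle n
halve {z} m n eq = ≡.trans (cong (ℤ._/ + 2) z≡) (i*2/2≡i (m ℤ.⊖ triangle n))
  where
  open ℤ-Solver
  z≡ : z ≡ (m ℤ.⊖ triangle n) ℤ.* + 2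
  z≡ = ≡.trans eq (≡.trans (cong (ℤ._-_ (+ m ℤ.* + 2)) (≡.sym (triangle*2 n)))
    (≡.trans (solve 2 (λ m t → m :* con (+ 2) :- t :* con (+ 2) := (m :- t) :* con (+ 2))
                ≡.refl (+ m) (+ triangle n))
      (cong (ℤ._* + 2) (ℤ.m-n≡m⊖n m (triangle n)))))

q^-triangle : ℕ → ℚ⟨q⟩
q^-triangle n = q ^ᶻ (0 ℤ.⊖ triangle n)

-- After multiplication by `q ^ triangle n`, both sides become `q ^ m`: apply `^ᶻ-⊖` once with `m`
-- and once with 0.
^ᶻ-split : ∀ m n → q ^ᶻ (m ℤ.⊖ triangle n) ≈ q ^ m * q^-triangle n
^ᶻ-split m n = *-cancelʳ (q ^ triangle n) (^-nonZero q-nonZero (triangle n)) (begin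
  q ^ᶻ (m ℤ.⊖ triangle n) * q ^ triangle n      ≈⟨ ^ᶻ-⊖ m (triangle n) ⟩
  q ^ m                                         ≈⟨ *-identityʳ (q ^ m) ⟨
  q ^ m * 1#                                    ≈⟨ *-congˡ (^ᶻ-⊖ 0 (triangle n)) ⟨
  q ^ m * (q^-triangle n * q ^ triangle n)      ≈⟨ *-assoc (q ^ m) (q^-triangle n) (q ^ triangle n) ⟨
  (q ^ m * q^-triangle n) * q ^ triangle n      ∎)

^ᶻ-halve : ∀ {z} m n → z ≡ + m ℤ.* + 2 ℤ.- + n ℤ.* (+ n ℤ.- + 1) → q ^ᶻ (z ℤ./ + 2) ≈ q ^ m * q^-triangle n
^ᶻ-halve m n eq = ≈-trans (reflexive (cong (λ e → q ^ᶻ e) (halve m n eq))) (^ᶻ-split m n)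

-triangle-exponent : ∀ n → q ^ᶻ (ℤ.- (+ n ℤ.* (+ n ℤ.- + 1)) ℤ./ + 2) ≈ 1# * q^-triangle n
-triangle-exponent n = ^ᶻ-halve 0 n (≡.sym (ℤ.+-identityˡ (ℤ.- (+ n ℤ.* (+ n ℤ.- + 1)))))

^ᶻ-scale : ∀ m n → q ^ᶻ (+ m ℤ.* + n) ≈ (q ^ n) ^ m
^ᶻ-scale m n = begin
  q ^ᶻ (+ m ℤ.* + n)  ≡⟨ cong (λ e → q ^ᶻ e) (ℤ.pos-* m n) ⟨
  q ^ (m ℕ.* n)       ≡⟨ cong (q ^_) (ℕ.*-comm m n) ⟩
  q ^ (n ℕ.* m)       ≈⟨ ^-assocʳ q n m ⟨
  (q ^ n) ^ m         ∎

-- In terms of Q = q^(n+1) and P = q^(-n(n-1)/2), the numerator of `C n` is Q + Q^3 + P + qQP - QP -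
-- qP - 2Q^2. This is (1 - Q)(P(1 - q) + Q(1 - Q)), so the denominator Q - 1 divides out.
C-closed : ∀ n → C n ≈ - (q^-triangle n * (1# - q) + q ^ suc n * (1# - q ^ suc n))
C-closed n = *-cancelʳ (Q - 1#) (q^[1+n]-1-nonZero n) (begin
  C n * (Q - 1#)
    ≈⟨ ÷-*-cancel _ (Q - 1#) {{q^[1+n]-1-nonZero n}} ⟩
  _
    ≈⟨ +-cong (+-cong (+-cong (+-cong (+-cong (+-cong e₁ e₂) e₃) e₄) (-‿cong e₅)) (-‿cong e₆))
         -- `2 × x` unfolds to `x + (x + 0#)`, hence the extra `+-identityʳ`.
         (-‿cong (+-cong e₇ (≈-trans (+-identityʳ _) e₇))) ⟩
  Q + Q ^ 3 + 1# * P + q * Q * P - Q * P - q * 1# * P - (Q ^ 2 + Q ^ 2)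
    ≈⟨ solve 3 (λ Q q P →
         Q :+ Q :^ 3 :+ con 1ℚ :* P :+ q :* Q :* P :- Q :* P :- q :* con 1ℚ :* P :- (Q :^ 2 :+ Q :^ 2)
         := :- (P :* (con 1ℚ :- q) :+ Q :* (con 1ℚ :- Q)) :* (Q :- con 1ℚ)) ≈-refl Q q P ⟩
  - (P * (1# - q) + Q * (1# - Q)) * (Q - 1#)
    ∎)
  where
  open ℚ⟨q⟩-Solver
  module Z = ℤ-Solver

  Q P : ℚ⟨q⟩
  Q = q ^ suc n
  P = q^-triangle n

  I : ℤ
  I = + n

  n+1 : n ℕ.+ 1 ≡ suc n
  n+1 = ℕ.+-comm n 1

  e₁ : q ^ᶻ (I ℤ.+ + 1) ≈ Q
  e₁ = reflexive (cong (q ^_) n+1)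

  e₂ : q ^ᶻ (+ 3 ℤ.* (I ℤ.+ + 1)) ≈ Q ^ 3
  e₂ = ≈-trans (^ᶻ-scale 3 (n ℕ.+ 1)) (reflexive (cong (λ m → (q ^ m) ^ 3) n+1))

  e₃ : q ^ᶻ (ℤ.- (I ℤ.* (I ℤ.- + 1)) ℤ./ + 2) ≈ 1# * P
  e₃ = -triangle-exponent n

  -- In `e₄`, `e₅` and `e₆` the offset above -n(n-1)/2 is n + 2, n + 1 and 1 respectively; the
  -- matching powers of `q` unfold to `q * Q`, `Q` and `q * 1#`.
  e₄ : q ^ᶻ (ℤ.- ((I ℤ.+ + 1) ℤ.* (I ℤ.- + 4)) ℤ./ + 2) ≈ q * Q * P
  e₄ = ^ᶻ-halve (2 ℕ.+ n) n (Z.solve 1 (λ i →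
    Z.:- ((i Z.:+ Z.con (+ 1)) Z.:* (i Z.:- Z.con (+ 4)))
    Z.:= (Z.con (+ 2) Z.:+ i) Z.:* Z.con (+ 2) Z.:- i Z.:* (i Z.:- Z.con (+ 1))) ≡.refl I)

  e₅ : q ^ᶻ ((+ 2 ℤ.+ + 3 ℤ.* I ℤ.- I ℤ.* I) ℤ./ + 2) ≈ Q * P
  e₅ = ^ᶻ-halve (1 ℕ.+ n) n (Z.solve 1 (λ i →
    Z.con (+ 2) Z.:+ Z.con (+ 3) Z.:* i Z.:- i Z.:* i
    Z.:= (Z.con (+ 1) Z.:+ i) Z.:* Z.con (+ 2) Z.:- i Z.:* (i Z.:- Z.con (+ 1))) ≡.refl I)

  e₆ : q ^ᶻ (ℤ.- ((I ℤ.+ + 1) ℤ.* (I ℤ.- + 2)) ℤ./ + 2) ≈ q * 1# * P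
  e₆ = ^ᶻ-halve 1 n (Z.solve 1 (λ i →
    Z.:- ((i Z.:+ Z.con (+ 1)) Z.:* (i Z.:- Z.con (+ 2)))
    Z.:= Z.con (+ 1) Z.:* Z.con (+ 2) Z.:- i Z.:* (i Z.:- Z.con (+ 1))) ≡.refl I)

  e₇ : q ^ᶻ (+ 2 ℤ.* (I ℤ.+ + 1)) ≈ Q ^ 2
  e₇ = ≈-trans (^ᶻ-scale 2 (n ℕ.+ 1)) (reflexive (cong (λ m → (q ^ m) ^ 2) n+1))

-- The recurrence

infix 10 t[_,_]

t[_,_] : ℕ → ℕ → ℚ⟨q⟩
t[ n , k ] = (q ^ᶻ (ℤ.- (+ k ℤ.* (+ k ℤ.- + 1)) ℤ./ + 2) ÷ qbinom n k) {{qbinom-nonZero n k}}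

-- A division-free description of `t[ n , k ]`. The factor multiplying it is nonzero, so this
-- determines the term, and all later facts about it are derived from here.
t[]-clear : ∀ n k → t[ n , k ] * (⟨ q ⨾ q ⟩ n * q ^ triangle k) ≈ ⟨ q ⨾ q ⟩ k * ⟨ q ⨾ q ⟩ (n ℕ.∸ k)
t[]-clear n k = begin
  t * (⟨ q ⨾ q ⟩ n * X)         ≈⟨ *-congˡ (*-congʳ (÷-*-cancel (⟨ q ⨾ q ⟩ n) D {{D≉0}})) ⟨
  t * ((qbinom n k * D) * X)
    ≈⟨ solve 4 (λ t b d x → t :* ((b :* d) :* x) := (t :* b) :* (d :* x)) ≈-refl t (qbinom n k) D X ⟩
  (t * qbinom n k) * (D * X)    ≈⟨ *-congʳ (÷-*-cancel _ (qbinom n k) {{qbinom-nonZero n k}}) ⟩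
  _ * (D * X)                   ≈⟨ *-congʳ (-triangle-exponent k) ⟩
  (1# * q^-triangle k) * (D * X)
    ≈⟨ solve 3 (λ p d x → (con 1ℚ :* p) :* (d :* x) := (p :* x) :* d) ≈-refl (q^-triangle k) D X ⟩
  (q^-triangle k * X) * D       ≈⟨ *-congʳ (^ᶻ-⊖ 0 (triangle k)) ⟩
  1# * D                        ≈⟨ *-identityˡ D ⟩
  D                             ∎
  where
  open ℚ⟨q⟩-Solver
  t D X : ℚ⟨q⟩
  t = t[ n , k ]
  D = ⟨ q ⨾ q ⟩ k * ⟨ q ⨾ q ⟩ (n ℕ.∸ k)
  X = q ^ triangle k
  D≉0 : NonZero D
  D≉0 = *-nonZero (⟨q⨾q⟩-nonZero k) (⟨q⨾q⟩-nonZero (n ℕ.∸ k))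

-- Multiplied by (q;q)_n q^(k(k+1)/2), both sides contain (q;q)_k (q;q)_(n-k). What remains on the
-- left is q^k (1 - q^(n-k+1)) + q^(n+1) (1 - q^(k+1)); the two terms q^(n+1) cancel, leaving q^k (1
-- - q^(n+2)).
t[]-recurrence : ∀ n k → k ℕ.≤ n →
  (1# - q ^ suc n) * (t[ suc n , k ] + q ^ suc n * t[ suc n , suc k ]) ≈ (1# - q * q ^ suc n) * t[ n , k ]
-- The extra factor `x` raises `q ^ triangle k` to `q ^ triangle (suc k)`, as clearing `t₂`
-- requires.
t[]-recurrence n k k≤n = *-cancelʳ (F * (X * x))
  (*-nonZero (⟨q⨾q⟩-nonZero n) (*-nonZero (^-nonZero q-nonZero (triangle k)) (^-nonZero q-nonZero k))) (begin
  ((1# - Q) * (t₁ + Q * t₂)) * (F * (X * x))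
    ≈⟨ solve 6 (λ Q t₁ t₂ F X x → ((con 1ℚ :- Q) :* (t₁ :+ Q :* t₂)) :* (F :* (X :* x))
         := x :* (t₁ :* ((F :* (con 1ℚ :- Q)) :* X)) :+ Q :* (t₂ :* ((F :* (con 1ℚ :- Q)) :* (x :* X))))
         ≈-refl Q t₁ t₂ F X x ⟩
  x * (t₁ * ((F * (1# - Q)) * X)) + Q * (t₂ * ((F * (1# - Q)) * (x * X)))
    ≈⟨ +-cong (*-congˡ clear₁) (*-congˡ clear₂) ⟩
  x * (Fₖ * (G * (1# - y))) + Q * ((Fₖ * (1# - q * x)) * G)
    ≈⟨ solve 6 (λ Q q x Fₖ G y → x :* (Fₖ :* (G :* (con 1ℚ :- y))) :+ Q :* ((Fₖ :* (con 1ℚ :- q :* x)) :* G)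
         := (Fₖ :* G) :* (x :- y :* x :+ Q :* (con 1ℚ :- q :* x))) ≈-refl Q q x Fₖ G y ⟩
  (Fₖ * G) * (x - y * x + Q * (1# - q * x))
    -- Here `k ≤ n` enters: the exponents n - k + 1 and k add up to n + 1 only if the subtraction is
    -- not truncated.
    ≈⟨ *-congˡ (+-congʳ (+-congˡ (-‿cong y*x≈Q))) ⟩
  (Fₖ * G) * (x - Q + Q * (1# - q * x))
    ≈⟨ *-congʳ (t[]-clear n k) ⟨
  (t₀ * (F * X)) * (x - Q + Q * (1# - q * x))
    ≈⟨ solve 6 (λ Q q x t₀ F X → (t₀ :* (F :* X)) :* (x :- Q :+ Q :* (con 1ℚ :- q :* x))
         := ((con 1ℚ :- q :* Q) :* t₀) :* (F :* (X :* x))) ≈-refl Q q x t₀ F X ⟩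
  ((1# - q * Q) * t₀) * (F * (X * x))
    ∎)
  where
  open ℚ⟨q⟩-Solver
  Q F X x y t₀ t₁ t₂ Fₖ G : ℚ⟨q⟩
  Q  = q ^ suc n
  F  = ⟨ q ⨾ q ⟩ n
  X  = q ^ triangle k
  x  = q ^ k
  y  = q ^ suc (n ℕ.∸ k)
  t₀ = t[ n , k ]
  t₁ = t[ suc n , k ]
  t₂ = t[ suc n , suc k ]
  Fₖ = ⟨ q ⨾ q ⟩ k
  G  = ⟨ q ⨾ q ⟩ (n ℕ.∸ k)

  y*x≈Q : y * x ≈ Q
  y*x≈Q = ≈-trans (≈-sym (^-homo-* q (suc (n ℕ.∸ k)) k)) (reflexive (cong (λ m → q ^ suc m) (ℕ.m∸n+n≡m k≤n)))

  clear₁ : t₁ * ((F * (1# - Q)) * X) ≈ Fₖ * (G * (1# - y))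
  clear₁ = begin
    t₁ * ((F * (1# - Q)) * X)           ≈⟨ *-congˡ (*-congʳ (⨾-suc q q n)) ⟨
    t₁ * (⟨ q ⨾ q ⟩ (suc n) * X)        ≈⟨ t[]-clear (suc n) k ⟩
    Fₖ * ⟨ q ⨾ q ⟩ (suc n ℕ.∸ k)        ≡⟨ cong (λ m → Fₖ * ⟨ q ⨾ q ⟩ m) (ℕ.+-∸-assoc 1 k≤n) ⟩
    Fₖ * ⟨ q ⨾ q ⟩ (suc (n ℕ.∸ k))      ≈⟨ *-congˡ (⨾-suc q q (n ℕ.∸ k)) ⟩
    Fₖ * (G * (1# - y))                 ∎

  clear₂ : t₂ * ((F * (1# - Q)) * (x * X)) ≈ (Fₖ * (1# - q * x)) * G
  clear₂ = begin
    t₂ * ((F * (1# - Q)) * (x * X))                   ≈⟨ *-congˡ (*-cong (⨾-suc q q n) (^-homo-* q k (triangle k))) ⟨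
    t₂ * (⟨ q ⨾ q ⟩ (suc n) * q ^ triangle (suc k))   ≈⟨ t[]-clear (suc n) (suc k) ⟩
    ⟨ q ⨾ q ⟩ (suc k) * G                             ≈⟨ *-congʳ (⨾-suc q q k) ⟩
    (Fₖ * (1# - q * x)) * G                           ∎

-- The boundary term at k = 0, which the sum over shifted indices `suc k` misses.
t[1+n,0] : ∀ n → t[ suc n , 0 ] ≈ 1#
t[1+n,0] n = *-cancelʳ F (⟨q⨾q⟩-nonZero (suc n)) (begin
  t[ suc n , 0 ] * F          ≈⟨ *-congˡ (*-identityʳ F) ⟨
  t[ suc n , 0 ] * (F * 1#)   ≈⟨ t[]-clear (suc n) 0 ⟩
  1# * F                       ∎)
  where
  F : ℚ⟨q⟩
  F = ⟨ q ⨾ q ⟩ (suc n)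

-- The boundary term at the top index k = n. It rests on [n+1, n] = (1 - q^(n+1)) / (1 - q), whose
-- numerator is cancelled by the factor in front.
t[1+n,n] : ∀ n → (1# - q ^ suc n) * t[ suc n , n ] ≈ q^-triangle n * (1# - q)
t[1+n,n] n = *-cancelʳ (F * X) (*-nonZero (⟨q⨾q⟩-nonZero n) (^-nonZero q-nonZero (triangle n))) (begin
  ((1# - Q) * t) * (F * X)
    ≈⟨ solve 4 (λ Q t F X → ((con 1ℚ :- Q) :* t) :* (F :* X) := t :* ((F :* (con 1ℚ :- Q)) :* X)) ≈-refl Q t F X ⟩
  t * ((F * (1# - Q)) * X)
    ≈⟨ *-congˡ (*-congʳ (⨾-suc q q n)) ⟨
  t * (⟨ q ⨾ q ⟩ (suc n) * X)
    ≈⟨ t[]-clear (suc n) n ⟩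
  F * ⟨ q ⨾ q ⟩ (suc n ℕ.∸ n)
    -- Since `suc n ∸ n` is 1, the second factor is (q;q)_1, which unfolds to `(1# - q * 1#) * 1#`.
    ≡⟨ cong (λ m → F * ⟨ q ⨾ q ⟩ m) (ℕ.m+n∸n≡m 1 n) ⟩
  F * ((1# - q * 1#) * 1#)
    ≈⟨ solve 2 (λ F q → F :* ((con 1ℚ :- q :* con 1ℚ) :* con 1ℚ) := con 1ℚ :* (F :* (con 1ℚ :- q))) ≈-refl F q ⟩
  1# * (F * (1# - q))
    ≈⟨ *-congʳ (^ᶻ-⊖ 0 (triangle n)) ⟨
  (P * X) * (F * (1# - q))
    ≈⟨ solve 4 (λ P X F q → (P :* X) :* (F :* (con 1ℚ :- q)) := (P :* (con 1ℚ :- q)) :* (F :* X)) ≈-refl P X F q ⟩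
  (P * (1# - q)) * (F * X)
    ∎)
  where
  open ℚ⟨q⟩-Solver
  Q t F X P : ℚ⟨q⟩
  Q = q ^ suc n
  t = t[ suc n , n ]
  F = ⟨ q ⨾ q ⟩ n
  X = q ^ triangle n
  P = q^-triangle n

reciprocalSum : ℕ → ℚ⟨q⟩
reciprocalSum n = ∑[ k < n ] t[ n , k ]

-- Sum the termwise recurrence over k < n; the two shifted sums on the left
-- each miss one term of reciprocalSum (suc n), and these boundary terms make up C n.
reciprocalSum-recurrence : ∀ n →
  (1# - q ^ suc n * q ^ suc n) * reciprocalSum (suc n) ≈ (1# - q * q ^ suc n) * reciprocalSum n - C n
reciprocalSum-recurrence n = begin
  (1# - Q * Q) * S′
    -- Splitting 1 - Q^2 as (1 - Q) + (1 - Q) Q gives two copies of the sum: the first then loses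
    -- its last term, the second its first term, so that they match the two terms of
    -- `t[]-recurrence`.
    ≈⟨ solve 2 (λ Q S → (con 1ℚ :- Q :* Q) :* S := (con 1ℚ :- Q) :* S :+ (con 1ℚ :- Q) :* (Q :* S)) ≈-refl Q S′ ⟩
  (1# - Q) * S′ + (1# - Q) * (Q * S′)
    ≈⟨ +-cong (*-congˡ (∑-last n (t[ suc n ,_]))) (*-congˡ (*-congˡ (+-congʳ (t[1+n,0] n)))) ⟩
  (1# - Q) * (A + t) + (1# - Q) * (Q * (1# + B))
    ≈⟨ solve 4 (λ Q A t B → (con 1ℚ :- Q) :* (A :+ t) :+ (con 1ℚ :- Q) :* (Q :* (con 1ℚ :+ B))
         := (con 1ℚ :- Q) :* (A :+ Q :* B) :+ ((con 1ℚ :- Q) :* t :+ Q :* (con 1ℚ :- Q))) ≈-refl Q A t B ⟩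
  (1# - Q) * (A + Q * B) + ((1# - Q) * t + Q * (1# - Q))
    ≈⟨ +-cong summed (+-congʳ (t[1+n,n] n)) ⟩
  (1# - q * Q) * S + (P * (1# - q) + Q * (1# - Q))
    ≈⟨ +-congˡ (-‿involutive _) ⟨
  (1# - q * Q) * S - - (P * (1# - q) + Q * (1# - Q))
    ≈⟨ +-congˡ (-‿cong (C-closed n)) ⟨
  (1# - q * Q) * S - C n
    ∎
  where
  open ℚ⟨q⟩-Solver
  Q P S S′ A B t : ℚ⟨q⟩
  Q  = q ^ suc n
  P  = q^-triangle n
  S  = reciprocalSum n
  S′ = reciprocalSum (suc n)
  A  = ∑[ k < n ] t[ suc n , k ]
  B  = ∑[ k < n ] t[ suc n , suc k ]
  t  = t[ suc n , n ]

  summed : (1# - Q) * (A + Q * B) ≈ (1# - q * Q) * S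
  summed = begin
    (1# - Q) * (A + Q * B)
      ≈⟨ *-congˡ (+-congˡ (*-distribˡ-sum {n} Q _)) ⟩
    (1# - Q) * (A + (∑[ k < n ] (Q * t[ suc n , suc k ])))
      ≈⟨ *-congˡ (∑-distrib-+ {n} _ _) ⟨
    (1# - Q) * (∑[ k < n ] (t[ suc n , k ] + Q * t[ suc n , suc k ]))
      ≈⟨ *-distribˡ-sum {n} (1# - Q) _ ⟩
    (∑[ k < n ] ((1# - Q) * (t[ suc n , k ] + Q * t[ suc n , suc k ])))
      ≈⟨ ∑-cong n (λ k k<n → t[]-recurrence n k (ℕ.<⇒≤ k<n)) ⟩
    (∑[ k < n ] ((1# - q * Q) * t[ n , k ]))
      ≈⟨ *-distribˡ-sum {n} (1# - q * Q) _ ⟨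
    (1# - q * Q) * S
      ∎

-- The recurrence for the right-hand side

prefactor : ℕ → ℚ⟨q⟩
prefactor n = (⟨ q ^ 2 ⨾ q ⟩ n ÷ ⟨ q ^ 2 ⨾ q ^ 2 ⟩ n) {{⟨q²⨾q²⟩-nonZero n}}

summand : ℕ → ℚ⟨q⟩
summand i = ((C i * ⟨ q ^ 2 ⨾ q ^ 2 ⟩ i) ÷ (⟨ q ^ 2 ⨾ q ⟩ i * (q ^ (2 ℕ.+ i) - 1#)))
  {{*-nonZero (⟨q²⨾q⟩-nonZero i) (q^[1+n]-1-nonZero (suc i))}}

-- Passing from n to n + 1 appends the factor 1 - q^(n+2) to the numerator and 1 - q^(2n+2) to the
-- denominator.
prefactor-recurrence : ∀ n →
  (1# - q ^ suc n * q ^ suc n) * prefactor (suc n) ≈ (1# - q * q ^ suc n) * prefactor n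
prefactor-recurrence n = *-cancelʳ E (⟨q²⨾q²⟩-nonZero n) (begin
  ((1# - Q * Q) * A′) * E
    ≈⟨ solve 3 (λ Q A E → ((con 1ℚ :- Q :* Q) :* A) :* E := A :* (E :* (con 1ℚ :- Q :* Q))) ≈-refl Q A′ E ⟩
  A′ * (E * (1# - Q * Q))
    -- `q ^ 2 * (q ^ 2) ^ n` is `(q ^ 2) ^ suc n` by definition, so `square` applies directly.
    ≈⟨ *-congˡ (*-congˡ (+-congˡ (-‿cong square))) ⟨
  A′ * (E * (1# - q ^ 2 * (q ^ 2) ^ n))
    ≈⟨ *-congˡ (⨾-suc (q ^ 2) (q ^ 2) n) ⟨
  A′ * ⟨ q ^ 2 ⨾ q ^ 2 ⟩ (suc n)
    ≈⟨ ÷-*-cancel _ (⟨ q ^ 2 ⨾ q ^ 2 ⟩ (suc n)) {{⟨q²⨾q²⟩-nonZero (suc n)}} ⟩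
  ⟨ q ^ 2 ⨾ q ⟩ (suc n)
    ≈⟨ ⨾-suc (q ^ 2) q n ⟩
  ⟨ q ^ 2 ⨾ q ⟩ n * (1# - q ^ 2 * q ^ n)
    ≈⟨ *-congʳ (÷-*-cancel _ E {{⟨q²⨾q²⟩-nonZero n}}) ⟨
  (A * E) * (1# - q ^ 2 * q ^ n)
    ≈⟨ solve 4 (λ q x A E → (A :* E) :* (con 1ℚ :- q :^ 2 :* x) := ((con 1ℚ :- q :* (q :* x)) :* A) :* E)
         ≈-refl q (q ^ n) A E ⟩
  ((1# - q * Q) * A) * E
    ∎)
  where
  open ℚ⟨q⟩-Solver
  Q E A A′ : ℚ⟨q⟩
  Q  = q ^ suc n
  E  = ⟨ q ^ 2 ⨾ q ^ 2 ⟩ n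
  A  = prefactor n
  A′ = prefactor (suc n)

  square : (q ^ 2) ^ suc n ≈ Q * Q
  square = begin
    (q ^ 2) ^ suc n     ≈⟨ ^-assocʳ q 2 (suc n) ⟩
    q ^ (2 ℕ.* suc n)   ≡⟨ cong (q ^_) (ℕ.*-comm 2 (suc n)) ⟩
    q ^ (suc n ℕ.* 2)   ≈⟨ ^-assocʳ q (suc n) 2 ⟨
    Q ^ 2               ≈⟨ *-congˡ (*-identityʳ Q) ⟩
    Q * Q               ∎

-- The Pochhammer symbols of the prefactor and of the summand are reciprocal, leaving C(n) /
-- (q^(n+2) - 1); the sign comes from 1 - q^(n+2) facing q^(n+2) - 1.
prefactor*summand : ∀ n → (1# - q * q ^ suc n) * (prefactor n * summand n) ≈ - C n
prefactor*summand n = *-cancelʳ H (⟨q²⨾q⟩-nonZero n) (begin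
  ((1# - qQ) * (A * B)) * H
    ≈⟨ solve 4 (λ Q A B H → ((con 1ℚ :- Q) :* (A :* B)) :* H := :- (A :* (B :* (H :* (Q :- con 1ℚ))))) ≈-refl qQ A B H ⟩
  - (A * (B * (H * (qQ - 1#))))
    ≈⟨ -‿cong (*-congˡ (÷-*-cancel _ (H * (qQ - 1#)) {{*-nonZero (⟨q²⨾q⟩-nonZero n) (q^[1+n]-1-nonZero (suc n))}})) ⟩
  - (A * (C n * E))
    ≈⟨ solve 3 (λ A c E → :- (A :* (c :* E)) := :- c :* (A :* E)) ≈-refl A (C n) E ⟩
  - C n * (A * E)
    ≈⟨ *-congˡ (÷-*-cancel _ E {{⟨q²⨾q²⟩-nonZero n}}) ⟩
  - C n * H
    ∎)
  where
  open ℚ⟨q⟩-Solver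
  qQ H E A B : ℚ⟨q⟩
  qQ = q * q ^ suc n
  H  = ⟨ q ^ 2 ⨾ q ⟩ n
  E  = ⟨ q ^ 2 ⨾ q ^ 2 ⟩ n
  A  = prefactor n
  B  = summand n

closedSum : ℕ → ℚ⟨q⟩
closedSum n = prefactor n * (∑[ i < n ] summand i)

-- The old terms of the sum scale with the prefactor, and the new term i = n contributes the
-- inhomogeneous part through `prefactor*summand`.
closedSum-recurrence : ∀ n →
  (1# - q ^ suc n * q ^ suc n) * closedSum (suc n) ≈ (1# - q * q ^ suc n) * closedSum n - C n
closedSum-recurrence n = begin
  D * (prefactor (suc n) * ∑< (suc n) summand)
    ≈⟨ *-assoc D (prefactor (suc n)) (∑< (suc n) summand) ⟨
  (D * prefactor (suc n)) * ∑< (suc n) summand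
    ≈⟨ *-cong (prefactor-recurrence n) (∑-last n summand) ⟩
  (N * A) * (Σ + B)
    ≈⟨ solve 4 (λ N A Σ B → (N :* A) :* (Σ :+ B) := N :* (A :* Σ) :+ N :* (A :* B)) ≈-refl N A Σ B ⟩
  N * (A * Σ) + N * (A * B)
    ≈⟨ +-congˡ (prefactor*summand n) ⟩
  N * closedSum n - C n
    ∎
  where
  open ℚ⟨q⟩-Solver
  D N A B Σ : ℚ⟨q⟩
  D = 1# - q ^ suc n * q ^ suc n
  N = 1# - q * q ^ suc n
  A = prefactor n
  B = summand n
  Σ = ∑< n summand

-- Comparison of the two sides

-- The value at q = 0 is 1. This is the leading coefficient of both recurrences, so the induction
-- step may cancel it.
1-q^[1+n]²-nonZero : ∀ n → NonZero (1# - q ^ suc n * q ^ suc n)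
1-q^[1+n]²-nonZero n =
  at0-nonZero (λ ()) (at0-+ at0-1 (at0-neg (at0-*-vanishes (at0-^ at0-q n) (at0-^ at0-q n))))

reciprocalSum≈closedSum : ∀ n → reciprocalSum n ≈ closedSum n
reciprocalSum≈closedSum ℕ.zero  = ≈-sym (zeroʳ (prefactor 0))
reciprocalSum≈closedSum (suc n) = *-cancelʳ D (1-q^[1+n]²-nonZero n) (begin
  reciprocalSum (suc n) * D                      ≈⟨ *-comm (reciprocalSum (suc n)) D ⟩
  D * reciprocalSum (suc n)                      ≈⟨ reciprocalSum-recurrence n ⟩
  (1# - q * q ^ suc n) * reciprocalSum n - C n   ≈⟨ +-congʳ (*-congˡ (reciprocalSum≈closedSum n)) ⟩
  (1# - q * q ^ suc n) * closedSum n - C n       ≈⟨ closedSum-recurrence n ⟨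
  D * closedSum (suc n)                          ≈⟨ *-comm D (closedSum (suc n)) ⟩
  closedSum (suc n) * D                          ∎)
  where
  D : ℚ⟨q⟩
  D = 1# - q ^ suc n * q ^ suc n

theorem2 : (n : ℕ) → 1 ℕ.≤ n →
    (∑[ k < n ] ((q ^ᶻ (ℤ.- (+ k ℤ.* (+ k ℤ.- + 1)) ℤ./ + 2) ÷ qbinom n k) {{qbinom-nonZero n k}}))
    ≈ (⟨ q ^ 2 ⨾ q ⟩ n ÷ ⟨ q ^ 2 ⨾ q ^ 2 ⟩ n) {{⟨q²⨾q²⟩-nonZero n}}
    * (∑[ i < n ] (((C i * ⟨ q ^ 2 ⨾ q ^ 2 ⟩ i) ÷ (⟨ q ^ 2 ⨾ q ⟩ i * (q ^ (2 ℕ.+ i) - 1#)))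
    {{*-nonZero (⟨q²⨾q⟩-nonZero i) (q^[1+n]-1-nonZero (suc i))}}))
theorem2 n _ = reciprocalSum≈closedSum n
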